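{- Let $G$ be a framed graph with framing $f$, and let $a,b\in V(G)$ be distinct vertices. Let $\widetilde G_{ab}$ be the framed graph on $V(G)$ obtained from $G$ as follows: for every vertex $c\ne a,b$, the adjacency of $c$ and $a$ is toggled iff $c$ is adjacent to $b$ in $G$; the adjacency of $a$ and $b$ is toggled iff $f(b)=1$; the framing of $a$ becomes $f(a)+f(b)\pmod 2$; all other adjacencies and framings are unchanged. Then $$D(\widetilde G_{ab})=\widetilde{D(G)}_{ab},$$ where $D(\cdot)$ denotes the nondegeneracy delta-matroid.
   Context: A framed graph is a simple graph $G$ with a map $f:V(G)\to\{0,1\}$; its adjacency matrix over $\mathbb{F}_2$ has diagonal entry $f(v)$ at $v$ and the usual off-diagonal entries. Its nondegeneracy delta-matroid is $D(G)=(V(G);\{U\subseteq V(G)\mid$ the adjacency matrix of the induced framed subgraph $G_U$ is nondegenerate over $\mathbb{F}_2\})$ (empty matrix counts as nondegenerate). For a set system $D=(E;\Phi)$ ($E$ finite, $\Phi\subseteq 2^E$ nonempty) and distinct $a,b\in E$, the sliding of $a$ over $b$ is $\widetilde D_{ab}=(E;\widetilde\Phi_{ab})$ with $\widetilde\Phi_{ab}=\Phi\,\Delta\,\{\phi\sqcup\{a\}\mid \phi\subseteq E\setminus\{a,b\},\ \phi\sqcup\{b\}\in\Phi\}$. -}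

module Defs where

open import Algebra.Bundles using (CommutativeRing)
open import Data.Bool.Base using (Bool; false; if_then_else_; _xor_)
import Data.Bool.Properties as Bool
open import Data.Bool.Properties using (xor-∧-commutativeRing)
open import Data.Fin.Base using (Fin; zero; suc; toℕ; punchIn)
open import Data.Fin.Properties using (_≟_)
open import Data.Fin.Subset
  using (Subset; inside; outside; ∣_∣; _∉_; _∪_; ⁅_⁆; ⊥)
open import Data.Fin.Subset.Properties
  using (_∈?_; anySubset?; ∣⊥∣≡0; x∈⁅x⁆; x∈⁅y⁆⇒x≡y; x∈p∪q⁺; x∈p∪q⁻)
open import Data.Nat.Base using (ℕ; zero; suc)
open import Data.Product.Base using (∃; ∃-syntax; _×_; _,_)
open import Data.Sum.Base using (_⊎_; inj₁; inj₂; [_,_]′)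
open import Data.Vec.Base using (_∷_)
open import Data.Vec.Properties using (≡-dec)
open import Level using (0ℓ)
open import Relation.Binary.PropositionalEquality
  using (_≡_; _≢_; refl; sym; cong)
open import Relation.Nullary using (¬_; yes; no; does)
open import Relation.Nullary.Decidable using (¬?; _×-dec_; _⊎-dec_)
open import Relation.Unary using (Pred; Decidable; _≐_)

private
  variable
    m n : ℕ

module Determinant {c ℓ} (R : CommutativeRing c ℓ) where
  open CommutativeRing R
    using (Carrier; _≈_; _*_; -_; 0#; 1#; semiring)
  open import Algebra.Properties.Semiring.Sum semiring using (sum)
  open import Algebra.Properties.Semiring.Exp semiring using (_^_)

  Matrix : ℕ → Set c
  Matrix m = Fin m → Fin m → Carrier

  minor : Fin (suc m) → Matrix (suc m) → Matrix m
  minor j M i k = M (suc i) (punchIn j k)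

  -- Laplace expansion along the first row; the empty matrix has
  -- determinant 1.
  det : Matrix m → Carrier
  det {zero}  M = 1#
  det {suc m} M = sum λ j → (- 1#) ^ toℕ j * (M zero j * det (minor j M))

  -- The usual notion when R is a field, as it is below.
  Nondegenerate : Matrix m → Set ℓ
  Nondegenerate M = ¬ (det M ≈ 0#)

-- The field 𝔽₂: false is 0, true is 1, addition is xor, multiplication is ∧.
𝔽₂ : CommutativeRing 0ℓ 0ℓ
𝔽₂ = xor-∧-commutativeRing

open Determinant 𝔽₂ public

record FramedGraph (n : ℕ) : Set where
  field
    adj       : Fin n → Fin n → Bool
    adj-sym   : ∀ i j → adj i j ≡ adj j i
    adj-irr   : ∀ i → adj i i ≡ false
    framing   : Fin n → Bool

open FramedGraph public

adjacencyMatrix : FramedGraph n → Matrix n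
adjacencyMatrix G i j = if does (i ≟ j) then framing G i else adj G i j

-- The elements of U in increasing order.
element : (U : Subset n) → Fin ∣ U ∣ → Fin n
element (outside ∷ U) i       = suc (element U i)
element (inside  ∷ U) zero    = zero
element (inside  ∷ U) (suc i) = suc (element U i)

-- G_U, with its vertices renumbered as 0, …, ∣ U ∣ - 1.
induced : FramedGraph n → (U : Subset n) → FramedGraph ∣ U ∣
induced G U = record
  { adj     = λ i j → adj G (element U i) (element U j)
  ; adj-sym = λ i j → adj-sym G (element U i) (element U j)
  ; adj-irr = λ i → adj-irr G (element U i)
  ; framing = λ i → framing G (element U i)
  }

-- Decidability of Feasible is what makes it a subset of 2^E in the
-- classical, finite sense.
record SetSystem (n : ℕ) : Set₁ where
  field
    Feasible  : Pred (Subset n) 0ℓ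
    feasible? : Decidable Feasible
    nonempty  : ∃ Feasible

open SetSystem public

infix 4 _≋_

-- Equality of set systems on the same ground set: the same feasible sets.
_≋_ : SetSystem n → SetSystem n → Set
D ≋ D′ = Feasible D ≐ Feasible D′

infixl 6 _Δ_

_Δ_ : Pred (Subset n) 0ℓ → Pred (Subset n) 0ℓ → Pred (Subset n) 0ℓ
(Φ Δ Ψ) U = (Φ U × ¬ Ψ U) ⊎ (¬ Φ U × Ψ U)

nondegeneracyDeltaMatroid : FramedGraph n → SetSystem n
nondegeneracyDeltaMatroid {n} G = record
  { Feasible  = λ U → Nondegenerate (adjacencyMatrix (induced G U))
  ; feasible? = λ U → ¬? (det (adjacencyMatrix (induced G U)) Bool.≟ false)
  ; nonempty  = ⊥ , empty-nondegenerate (∣⊥∣≡0 n) _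
  }
  where
  empty-nondegenerate : m ≡ 0 → (M : Matrix m) → Nondegenerate M
  empty-nondegenerate refl M ()

module _ (Φ : Pred (Subset n) 0ℓ) (a b : Fin n) where

  -- { φ ⊔ {a} ∣ φ ⊆ E ∖ {a , b}, φ ⊔ {b} ∈ Φ }
  Exchanged : Pred (Subset n) 0ℓ
  Exchanged U =
    ∃[ φ ] (a ∉ φ × b ∉ φ × Φ (φ ∪ ⁅ b ⁆) × U ≡ φ ∪ ⁅ a ⁆)

  exchanged? : Decidable Φ → Decidable Exchanged
  exchanged? Φ? U = anySubset? λ φ →
    ¬? (a ∈? φ) ×-dec ¬? (b ∈? φ) ×-dec
    Φ? (φ ∪ ⁅ b ⁆) ×-dec ≡-dec Bool._≟_ U (φ ∪ ⁅ a ⁆)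

  exchanged⇒b∉ : a ≢ b → ∀ {U} → Exchanged U → b ∉ U
  exchanged⇒b∉ a≢b (φ , _ , b∉φ , _ , refl) b∈ =
    [ b∉φ , (λ b∈a → a≢b (sym (x∈⁅y⁆⇒x≡y a b∈a))) ]′ (x∈p∪q⁻ φ ⁅ a ⁆ b∈)

-- The sliding of a over b.
slide : SetSystem n → (a b : Fin n) → a ≢ b → SetSystem n
slide D a b a≢b = record
  { Feasible  = Feasible D Δ Ψ
  ; feasible? = λ U → (feasible? D U ×-dec ¬? (Ψ? U))
                      ⊎-dec (¬? (feasible? D U) ×-dec Ψ? U)
  ; nonempty  = slide-nonempty (nonempty D)
  }
  where
  Ψ  = Exchanged (Feasible D) a b
  Ψ? = exchanged? (Feasible D) a b (feasible? D)

  slide-nonempty : ∃ (Feasible D) → ∃ (Feasible D Δ Ψ)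
  slide-nonempty (U , ΦU) with Ψ? U
  ... | no ¬ΨU = U , inj₁ (ΦU , ¬ΨU)
  ... | yes (φ , _ , _ , Φφb , _) = φ ∪ ⁅ b ⁆ , inj₁ (Φφb , λ Ψφb →
          exchanged⇒b∉ (Feasible D) a b a≢b Ψφb
            (x∈p∪q⁺ {p = φ} (inj₂ (x∈⁅x⁆ b))))

module _ (G : FramedGraph n) (a b : Fin n) where

  -- Whether the adjacency of a and c (c ≢ a) is toggled.
  toggled : Fin n → Bool
  toggled c = if does (c ≟ b) then framing G b else adj G c b

  slideAdj : Fin n → Fin n → Bool
  slideAdj i j with i ≟ a | j ≟ a
  ... | yes _ | yes _ = false
  ... | yes _ | no  _ = adj G i j xor toggled j
  ... | no  _ | yes _ = adj G i j xor toggled i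
  ... | no  _ | no  _ = adj G i j

  slideFraming : Fin n → Bool
  slideFraming i =
    if does (i ≟ a) then framing G a xor framing G b else framing G i

  slideAdj-sym : ∀ i j → slideAdj i j ≡ slideAdj j i
  slideAdj-sym i j with i ≟ a | j ≟ a
  ... | yes _ | yes _ = refl
  ... | yes _ | no  _ = cong (_xor toggled j) (adj-sym G i j)
  ... | no  _ | yes _ = cong (_xor toggled i) (adj-sym G i j)
  ... | no  _ | no  _ = adj-sym G i j

  slideAdj-irr : ∀ i → slideAdj i i ≡ false
  slideAdj-irr i with i ≟ a
  ... | yes _ = refl
  ... | no  _ = adj-irr G i

  -- The graph G̃_ab; intended for a ≢ b.
  slideGraph : FramedGraph n
  slideGraph = record
    { adj     = slideAdj
    ; adj-sym = slideAdj-sym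
    ; adj-irr = slideAdj-irr
    ; framing = slideFraming
    }

{-# OPTIONS --safe #-}
-- Over 𝔽₂ the determinant is the permanent, which does not depend on the
-- order of rows and columns, so a principal minor M[U] can be computed from
-- any listing of U.  Let s be a formal vertex whose row and column are the
-- sums of those of a and b.  Sliding a over b puts s in the place of a.  For a
-- set U = φ ⊔ {a}, bilinearity gives
--   M[s , φ] = M[a , φ] + M[b , φ],
-- the two mixed terms cancelling as transposes of each other.  If b ∈ φ, the
-- last term vanishes because b is repeated; otherwise it is the principal
-- minor of G on φ ⊔ {b}.
module Submission where

open import Algebra.Bundles using (CommutativeRing)
import Algebra.Properties.CommutativeSemigroup as CommutativeSemigroupProperties
import Algebra.Properties.Semiring.Exp as Exp
import Algebra.Properties.Semiring.Sum as Sum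
open import Data.Bool.Base
  using (Bool; true; false; if_then_else_; not; _∧_; _xor_)
import Data.Bool.Properties as Bool
open import Data.Bool.Properties
  using (xor-same; xor-assoc; xor-comm; xor-identityʳ; not-¬; ¬-not;
         ∧-distribˡ-xor; ∧-distribʳ-xor; ∧-zeroʳ)
open import Data.Fin.Base using (Fin; zero; suc; toℕ; punchIn)
open import Data.Fin.Properties using (_≟_; suc-injective)
open import Data.Fin.Subset
  using (Subset; inside; outside; _∈_; _∉_; _∪_; ⁅_⁆)
open import Data.Fin.Subset.Properties
  using (_∈?_; ∪-identityʳ; drop-there)
open import Data.List.Base using (List; []; _∷_; map; tabulate)
open import Data.List.Properties using (map-cong-local; map-tabulate)
open import Data.List.Relation.Binary.Permutation.Propositional as ↭
  using (_↭_; ↭-refl; ↭-prep; ↭-swap; ↭-trans; ↭-reflexive)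
open import Data.List.Relation.Binary.Permutation.Propositional.Properties
  using (map⁺)
import Data.List.Relation.Unary.All.Properties as All
open import Data.Maybe.Base using (Maybe; just; nothing)
open import Data.Nat.Base using (ℕ; zero; suc)
open import Data.Product.Base using (∃-syntax; _×_; _,_)
open import Data.Sum.Base using (inj₁; inj₂)
open import Data.Vec.Base using (_∷_; here; there)
open import Function.Base using (_∘_; flip)
open import Relation.Binary.PropositionalEquality
  using (_≡_; _≢_; refl; sym; trans; cong; cong₂; subst; ≢-sym; module ≡-Reasoning)
open import Relation.Nullary using (¬_; yes; no; does; contradiction)
open import Relation.Nullary.Decidable using (dec-true; dec-false)
open import Defs

open CommutativeRing 𝔽₂
  using (semiring; +-commutativeSemigroup; *-commutativeSemigroup)
open CommutativeSemigroupProperties +-commutativeSemigroup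
  using (interchange; x∙yz≈y∙xz)
open Exp semiring using (_^_)
open Sum semiring using (sum; sum-cong-≗)
open ≡-Reasoning

module ∧ = CommutativeSemigroupProperties *-commutativeSemigroup

private
  variable
    X Y X′ Y′ : Set
    m n : ℕ

-- Sums over the choice of one entry of a list

-- The sum of F x xs over all ways to pick an entry x of a list, leaving xs.
Σpick : (X → List X → Bool) → List X → Bool
Σpick F []       = false
Σpick F (x ∷ xs) = F x xs xor Σpick (λ y ys → F y (x ∷ ys)) xs

Σpick-cong : {F H : X → List X → Bool} → (∀ x xs → F x xs ≡ H x xs) →
  ∀ xs → Σpick F xs ≡ Σpick H xs
Σpick-cong F≡H []       = refl
Σpick-cong F≡H (x ∷ xs) =
  cong₂ _xor_ (F≡H x xs) (Σpick-cong (λ y ys → F≡H y (x ∷ ys)) xs)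

Σpick-zero : (xs : List X) → Σpick (λ _ _ → false) xs ≡ false
Σpick-zero []       = refl
Σpick-zero (x ∷ xs) = Σpick-zero xs

Σpick-xor : (F H : X → List X → Bool) → ∀ xs →
  Σpick (λ x xs → F x xs xor H x xs) xs ≡ Σpick F xs xor Σpick H xs
Σpick-xor F H []       = refl
Σpick-xor F H (x ∷ xs) = trans
  (cong ((F x xs xor H x xs) xor_) (Σpick-xor _ _ xs))
  (interchange (F x xs) (H x xs) _ _)

∧-Σpick : ∀ b (F : X → List X → Bool) xs →
  b ∧ Σpick F xs ≡ Σpick (λ x xs → b ∧ F x xs) xs
∧-Σpick b F []       = ∧-zeroʳ b
∧-Σpick b F (x ∷ xs) = trans
  (∧-distribˡ-xor b (F x xs) _)
  (cong ((b ∧ F x xs) xor_) (∧-Σpick b _ xs))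

Σpick-swap : (F : X → List X → Y → List Y → Bool) → ∀ xs ys →
  Σpick (λ x xs → Σpick (F x xs) ys) xs ≡
  Σpick (λ y ys → Σpick (λ x xs → F x xs y ys) xs) ys
Σpick-swap F []       ys = sym (Σpick-zero ys)
Σpick-swap F (x ∷ xs) ys = trans
  (cong (Σpick (F x xs) ys xor_) (Σpick-swap _ xs ys))
  (sym (Σpick-xor (F x xs) _ ys))

Σpick-map : (F : X′ → List X′ → Bool) (f : X → X′) → ∀ xs →
  Σpick F (map f xs) ≡ Σpick (λ x xs → F (f x) (map f xs)) xs
Σpick-map F f []       = refl
Σpick-map F f (x ∷ xs) = cong (F (f x) (map f xs) xor_) (Σpick-map _ f xs)

-- Picking entry `j` leaves the tabulation along `punchIn j`, which is how `minor` deletes a column;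
-- this links `perm` to the Laplace expansion.
Σpick-tabulate : (F : X → List X → Bool) (f : Fin (suc m) → X) →
  Σpick F (tabulate f) ≡ sum λ j → F (f j) (tabulate (f ∘ punchIn j))
Σpick-tabulate {m = zero}  F f = refl
Σpick-tabulate {m = suc m} F f =
  cong (F (f zero) _ xor_) (Σpick-tabulate (λ y ys → F y (f zero ∷ ys)) (f ∘ suc))

-- Permanents of matrices indexed by lists

-- The permanent, over 𝔽₂, of the matrix M r c with r ∈ rs and c ∈ cs; 0 if
-- the lists have different lengths.
perm : (X → Y → Bool) → List X → List Y → Bool
perm M []       []       = true
perm M []       (_ ∷ _)  = false
perm M (r ∷ rs) cs       = Σpick (λ c cs → M r c ∧ perm M rs cs) cs

perm-cong : {M N : X → Y → Bool} → (∀ r c → M r c ≡ N r c) →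
  ∀ rs cs → perm M rs cs ≡ perm N rs cs
perm-cong M≡N []       []      = refl
perm-cong M≡N []       (_ ∷ _) = refl
perm-cong M≡N (r ∷ rs) cs      =
  Σpick-cong (λ c cs → cong₂ _∧_ (M≡N r c) (perm-cong M≡N rs cs)) cs

perm-map : (M : X′ → Y′ → Bool) (f : X → X′) (g : Y → Y′) → ∀ rs cs →
  perm M (map f rs) (map g cs) ≡ perm (λ r c → M (f r) (g c)) rs cs
perm-map M f g []       []      = refl
perm-map M f g []       (_ ∷ _) = refl
perm-map M f g (r ∷ rs) cs      = trans
  (Σpick-map _ g cs)
  (Σpick-cong (λ c cs → cong (M (f r) (g c) ∧_) (perm-map M f g rs cs)) cs)

-- Picking `c` in row `r` gives the first summand on both sides. The remaining terms choose a column
-- `d` for `r` and a row `s` for `c`, and without signs these two choices can be made in either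
-- order.
perm-expandColumn : (M : X → Y → Bool) → ∀ rs c cs →
  perm M rs (c ∷ cs) ≡ Σpick (λ r rs → M r c ∧ perm M rs cs) rs
perm-expandColumn M []       c cs = refl
perm-expandColumn M (r ∷ rs) c cs = cong ((M r c ∧ perm M rs cs) xor_) (begin
  Σpick (λ d ds → M r d ∧ perm M rs (c ∷ ds)) cs
    ≡⟨ Σpick-cong (λ d ds → trans
         (cong (M r d ∧_) (perm-expandColumn M rs c ds))
         (∧-Σpick (M r d) _ rs)) cs ⟩
  Σpick (λ d ds → Σpick (λ s ss → M r d ∧ (M s c ∧ perm M ss ds)) rs) cs
    ≡⟨ Σpick-swap _ cs rs ⟩
  Σpick (λ s ss → Σpick (λ d ds → M r d ∧ (M s c ∧ perm M ss ds)) cs) rs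
    ≡⟨ Σpick-cong (λ s ss → trans
         (Σpick-cong (λ d ds → ∧.x∙yz≈y∙xz (M r d) (M s c) _) cs)
         (sym (∧-Σpick (M s c) _ cs))) rs ⟩
  Σpick (λ s ss → M s c ∧ perm M (r ∷ ss) cs) rs ∎)

-- Expansion along the first row of `M` is expansion along the first column of its transpose.
perm-flip : (M : X → Y → Bool) → ∀ rs cs → perm M rs cs ≡ perm (flip M) cs rs
perm-flip M []       []       = refl
perm-flip M []       (_ ∷ _)  = refl
perm-flip M (r ∷ rs) cs       = trans
  (Σpick-cong (λ c cs → cong (M r c ∧_) (perm-flip M rs cs)) cs)
  (sym (perm-expandColumn (flip M) cs r rs))

-- Induction on the columns: in the expansion along the first one, the terms of `x` and `y` trade
-- places, and every other term keeps both rows on top of a smaller matrix.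
perm-swapRows : (M : X → Y → Bool) → ∀ x y rs cs →
  perm M (x ∷ y ∷ rs) cs ≡ perm M (y ∷ x ∷ rs) cs
perm-swapRows M x y rs []       = refl
perm-swapRows M x y rs (c ∷ cs) = begin
  perm M (x ∷ y ∷ rs) (c ∷ cs)
    ≡⟨ perm-expandColumn M (x ∷ y ∷ rs) c cs ⟩
  (M x c ∧ perm M (y ∷ rs) cs) xor ((M y c ∧ perm M (x ∷ rs) cs) xor
    Σpick (λ s ss → M s c ∧ perm M (x ∷ y ∷ ss) cs) rs)
    ≡⟨ x∙yz≈y∙xz (M x c ∧ perm M (y ∷ rs) cs) (M y c ∧ perm M (x ∷ rs) cs) _ ⟩
  (M y c ∧ perm M (x ∷ rs) cs) xor ((M x c ∧ perm M (y ∷ rs) cs) xor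
    Σpick (λ s ss → M s c ∧ perm M (x ∷ y ∷ ss) cs) rs)
    ≡⟨ cong (λ p → (M y c ∧ perm M (x ∷ rs) cs) xor
                   ((M x c ∧ perm M (y ∷ rs) cs) xor p))
         (Σpick-cong (λ s ss → cong (M s c ∧_) (perm-swapRows M x y ss cs)) rs) ⟩
  (M y c ∧ perm M (x ∷ rs) cs) xor ((M x c ∧ perm M (y ∷ rs) cs) xor
    Σpick (λ s ss → M s c ∧ perm M (y ∷ x ∷ ss) cs) rs)
    ≡⟨ perm-expandColumn M (y ∷ x ∷ rs) c cs ⟨
  perm M (y ∷ x ∷ rs) (c ∷ cs) ∎

perm-↭-rows : (M : X → Y → Bool) → ∀ {rs rs′} → rs ↭ rs′ → ∀ cs →
  perm M rs cs ≡ perm M rs′ cs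
perm-↭-rows M ↭.refl         cs = refl
perm-↭-rows M (↭.prep r p)   cs =
  Σpick-cong (λ c cs → cong (M r c ∧_) (perm-↭-rows M p cs)) cs
perm-↭-rows M (↭.swap {xs = rs} x y p) cs = trans
  (perm-swapRows M x y rs cs)
  (Σpick-cong (λ d ds → cong (M y d ∧_)
    (Σpick-cong (λ c cs → cong (M x c ∧_) (perm-↭-rows M p cs)) ds)) cs)
perm-↭-rows M (↭.trans p q)  cs =
  trans (perm-↭-rows M p cs) (perm-↭-rows M q cs)

-- In the expansion along the first column, the terms of the two equal rows cancel in characteristic
-- 2, and every other term still has the repeated row.
perm-repeatedRow : (M : X → Y → Bool) → ∀ y rs cs →
  perm M (y ∷ y ∷ rs) cs ≡ false
perm-repeatedRow M y rs []       = refl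
perm-repeatedRow M y rs (c ∷ cs) = begin
  perm M (y ∷ y ∷ rs) (c ∷ cs)
    ≡⟨ perm-expandColumn M (y ∷ y ∷ rs) c cs ⟩
  p xor (p xor Σpick (λ s ss → M s c ∧ perm M (y ∷ y ∷ ss) cs) rs)
    ≡⟨ xor-assoc p p _ ⟨
  (p xor p) xor Σpick (λ s ss → M s c ∧ perm M (y ∷ y ∷ ss) cs) rs
    ≡⟨ cong₂ _xor_ (xor-same p) (Σpick-cong (λ s ss → trans
         (cong (M s c ∧_) (perm-repeatedRow M y ss cs)) (∧-zeroʳ (M s c))) rs) ⟩
  Σpick (λ _ _ → false) rs
    ≡⟨ Σpick-zero rs ⟩
  false ∎
  where p = M y c ∧ perm M (y ∷ rs) cs

perm-additive : (M : X → Y → Bool) → ∀ {s x y} →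
  (∀ c → M s c ≡ M x c xor M y c) → ∀ rs cs →
  perm M (s ∷ rs) cs ≡ perm M (x ∷ rs) cs xor perm M (y ∷ rs) cs
perm-additive M {s} {x} {y} s≡x+y rs cs = trans
  (Σpick-cong (λ c cs → trans
    (cong (_∧ perm M rs cs) (s≡x+y c))
    (∧-distribʳ-xor (perm M rs cs) (M x c) (M y c))) cs)
  (Σpick-xor _ _ cs)

-- Principal minors of symmetric matrices

xor-cancel : ∀ p q r → (p xor q) xor (q xor r) ≡ p xor r
xor-cancel p q r = begin
  (p xor q) xor (q xor r)  ≡⟨ xor-assoc p q (q xor r) ⟩
  p xor (q xor (q xor r))  ≡⟨ cong (p xor_) (xor-assoc q q r) ⟨
  p xor ((q xor q) xor r)  ≡⟨ cong (λ t → p xor (t xor r)) (xor-same q) ⟩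
  p xor r                  ∎

principal : (X → X → Bool) → List X → Bool
principal M xs = perm M xs xs

-- Rows are reordered directly, columns as rows of the transpose.
principal-↭ : (M : X → X → Bool) → ∀ {xs ys} → xs ↭ ys →
  principal M xs ≡ principal M ys
principal-↭ M {xs} {ys} p = begin
  perm M xs xs         ≡⟨ perm-↭-rows M p xs ⟩
  perm M ys xs         ≡⟨ perm-flip M ys xs ⟩
  perm (flip M) xs ys  ≡⟨ perm-↭-rows (flip M) p ys ⟩
  perm (flip M) ys ys  ≡⟨ perm-flip M ys ys ⟨
  perm M ys ys         ∎

module _ {M : X → X → Bool} (M-sym : ∀ x y → M x y ≡ M y x) where

  perm-sym : ∀ rs cs → perm M rs cs ≡ perm M cs rs
  perm-sym rs cs =
    trans (perm-flip M rs cs) (perm-cong (λ x y → M-sym y x) cs rs)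

  -- With `zs` fixed, `P u v` is symmetric and additive in each argument, so in characteristic 2 its
  -- diagonal `P u u` is additive too.
  principal-additive : ∀ s x y → (∀ z → M s z ≡ M x z xor M y z) → ∀ zs →
    principal M (s ∷ zs) ≡ principal M (x ∷ zs) xor principal M (y ∷ zs)
  principal-additive s x y s≡x+y zs = begin
    P s s                              ≡⟨ additive (s ∷ zs) ⟩
    P x s xor P y s                    ≡⟨ cong₂ _xor_ (right x) (right y) ⟩
    (P x x xor P x y) xor (P y x xor P y y)
      ≡⟨ cong (λ p → (P x x xor P x y) xor (p xor P y y))
           (perm-sym (y ∷ zs) (x ∷ zs)) ⟩
    (P x x xor P x y) xor (P x y xor P y y)
      ≡⟨ xor-cancel (P x x) (P x y) (P y y) ⟩
    P x x xor P y y                    ∎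
    where
    P : X → X → Bool
    P u v = perm M (u ∷ zs) (v ∷ zs)

    additive = perm-additive M s≡x+y zs

    right : ∀ u → P u s ≡ P u x xor P u y
    right u = begin
      P u s            ≡⟨ perm-sym (u ∷ zs) (s ∷ zs) ⟩
      P s u            ≡⟨ additive (u ∷ zs) ⟩
      P x u xor P y u
        ≡⟨ cong₂ _xor_ (perm-sym (x ∷ zs) (u ∷ zs)) (perm-sym (y ∷ zs) (u ∷ zs)) ⟩
      P u x xor P u y  ∎

-- Determinants as permanents

-- In 𝔽₂ the element `- 1#` is `true`, so every sign in the Laplace expansion is 1.
true^ : ∀ k → true ^ k ≡ true
true^ zero    = refl
true^ (suc k) = true^ k

-- Rows and columns need separate listings `ρ` and `γ`: a minor drops the first row but an arbitrary
-- column, so the induction leaves the principal case.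
det≡perm : (M : Matrix m) (N : X → Y → Bool) (ρ : Fin m → X) (γ : Fin m → Y) →
  (∀ i j → M i j ≡ N (ρ i) (γ j)) → det M ≡ perm N (tabulate ρ) (tabulate γ)
det≡perm {m = zero}  M N ρ γ M≡N = refl
det≡perm {m = suc m} M N ρ γ M≡N = trans
  (sum-cong-≗ λ j → cong₂ _∧_ (true^ (toℕ j)) (cong₂ _∧_ (M≡N zero j)
    (det≡perm (minor j M) N (ρ ∘ suc) (γ ∘ punchIn j)
      λ i k → M≡N (suc i) (punchIn j k))))
  (sym (Σpick-tabulate (λ c cs → N (ρ zero) c ∧ perm N (tabulate (ρ ∘ suc)) cs) γ))

-- Listing the elements of a subset

element-injective : ∀ (U : Subset n) {i j} → element U i ≡ element U j → i ≡ j
element-injective (outside ∷ U)                 eq =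
  element-injective U (suc-injective eq)
element-injective (inside  ∷ U) {zero}  {zero}  eq = refl
element-injective (inside  ∷ U) {suc i} {suc j} eq =
  cong suc (element-injective U (suc-injective eq))

element-∈ : ∀ (U : Subset n) i → element U i ∈ U
element-∈ (outside ∷ U) i       = there (element-∈ U i)
element-∈ (inside  ∷ U) zero    = here
element-∈ (inside  ∷ U) (suc i) = there (element-∈ U i)

members : Subset n → List (Fin n)
members U = tabulate (element U)

-- The listing is increasing, so `x` has to be moved to the front; by `principal-↭` this does not
-- affect principal minors.
members-∪⁅⁆ : ∀ (U : Subset n) {x} → x ∉ U → members (U ∪ ⁅ x ⁆) ↭ x ∷ members U
members-∪⁅⁆ (inside  ∷ U) {zero}  x∉U = contradiction here x∉U
members-∪⁅⁆ (outside ∷ U) {zero}  x∉U rewrite ∪-identityʳ U = ↭-refl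
members-∪⁅⁆ (s ∷ U)       {suc x} x∉U = cons s
  where
  tail : tabulate (suc ∘ element (U ∪ ⁅ x ⁆)) ↭ suc x ∷ tabulate (suc ∘ element U)
  tail = subst (tabulate (suc ∘ element (U ∪ ⁅ x ⁆)) ↭_)
    (cong (suc x ∷_) (map-tabulate (element U) suc))
    (↭-trans (↭-reflexive (sym (map-tabulate (element (U ∪ ⁅ x ⁆)) suc)))
             (map⁺ suc (members-∪⁅⁆ U (x∉U ∘ there))))

  cons : ∀ s → members ((s ∷ U) ∪ ⁅ suc x ⁆) ↭ suc x ∷ members (s ∷ U)
  cons outside = tail
  cons inside  = ↭-trans (↭-prep zero tail) (↭-swap zero (suc x) ↭-refl)

-- Brings a set containing `x` into the form used by `Exchanged` and `members-∪⁅⁆`.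
∈⇒∪⁅⁆ : ∀ {U : Subset n} {x} → x ∈ U → ∃[ φ ] (x ∉ φ × U ≡ φ ∪ ⁅ x ⁆)
∈⇒∪⁅⁆ {U = inside ∷ U} here =
  outside ∷ U , (λ ()) , cong (inside ∷_) (sym (∪-identityʳ U))
∈⇒∪⁅⁆ {U = s ∷ U} (there x∈U) with ∈⇒∪⁅⁆ x∈U
... | φ , x∉φ , eq = s ∷ φ , x∉φ ∘ drop-there , cong₂ _∷_ (sym (Bool.∨-identityʳ s)) eq

-- Adjacency matrices and induced subgraphs

module _ (G : FramedGraph n) where

  private
    A = adjacencyMatrix G

  adjacencyMatrix-diag : ∀ i → A i i ≡ framing G i
  adjacencyMatrix-diag i rewrite dec-true (i ≟ i) refl = refl

  adjacencyMatrix-off : ∀ {i j} → i ≢ j → A i j ≡ adj G i j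
  adjacencyMatrix-off {i} {j} i≢j rewrite dec-false (i ≟ j) i≢j = refl

  adjacencyMatrix-sym : ∀ i j → A i j ≡ A j i
  adjacencyMatrix-sym i j with i ≟ j
  ... | yes refl = sym (adjacencyMatrix-diag i)
  ... | no  i≢j  = trans (adj-sym G i j) (sym (adjacencyMatrix-off (≢-sym i≢j)))

  det-induced : ∀ U →
    det (adjacencyMatrix (induced G U)) ≡ principal A (members U)
  det-induced U = det≡perm _ A (element U) (element U) entry
    where
    entry : ∀ i j → adjacencyMatrix (induced G U) i j ≡ A (element U i) (element U j)
    entry i j with i ≟ j
    ... | yes refl = sym (adjacencyMatrix-diag (element U i))
    -- The induced matrix compares indices while `A` compares vertices, so distinct indices must
    -- give distinct vertices.
    ... | no  i≢j  = sym (adjacencyMatrix-off (i≢j ∘ element-injective U))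

-- Determinants of the slid graph

module _ (G : FramedGraph n) (a b : Fin n) where

  private
    A   = adjacencyMatrix G
    G̃  = slideGraph G a b
    d d̃ : Subset n → Bool
    d U = det (adjacencyMatrix (induced G U))
    d̃ U = det (adjacencyMatrix (induced G̃ U))

  -- The vertex nothing is the formal sum a + b.
  extended : Maybe (Fin n) → Maybe (Fin n) → Bool
  extended (just i) (just j) = A i j
  extended (just i) nothing  = A i a xor A i b
  extended nothing  (just j) = A a j xor A b j
  -- Bilinearity would also contribute `A a b` and `A b a`, which cancel; what remains is the new
  -- framing of `a`.
  extended nothing  nothing  = A a a xor A b b

  extended-sym : ∀ x y → extended x y ≡ extended y x
  extended-sym (just i) (just j) = adjacencyMatrix-sym G i j
  extended-sym (just i) nothing  =
    cong₂ _xor_ (adjacencyMatrix-sym G i a) (adjacencyMatrix-sym G i b)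
  extended-sym nothing  (just j) =
    cong₂ _xor_ (adjacencyMatrix-sym G a j) (adjacencyMatrix-sym G b j)
  extended-sym nothing  nothing  = refl

  extended-additive : ∀ z →
    extended nothing z ≡ extended (just a) z xor extended (just b) z
  extended-additive (just j) = refl
  extended-additive nothing  = sym (begin
    (A a a xor A a b) xor (A b a xor A b b)
      ≡⟨ cong (λ p → (A a a xor A a b) xor (p xor A b b)) (adjacencyMatrix-sym G b a) ⟩
    (A a a xor A a b) xor (A a b xor A b b)
      ≡⟨ xor-cancel (A a a) (A a b) (A b b) ⟩
    A a a xor A b b ∎)

  relabel : Fin n → Maybe (Fin n)
  relabel i = if does (i ≟ a) then nothing else just i

  relabel-a : relabel a ≡ nothing
  relabel-a rewrite dec-true (a ≟ a) refl = refl

  relabel-≢a : ∀ {i} → i ≢ a → relabel i ≡ just i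
  relabel-≢a {i} i≢a rewrite dec-false (i ≟ a) i≢a = refl

  relabel-members : ∀ {U} → a ∉ U → map relabel (members U) ≡ map just (members U)
  relabel-members {U} a∉U = map-cong-local (All.tabulate⁺ λ i →
    relabel-≢a λ eq → a∉U (subst (_∈ U) eq (element-∈ U i)))

  -- The case split in `toggled` is the one between diagonal and off-diagonal entries of `A`, so the
  -- toggling adds column `b` throughout.
  toggled≡ : ∀ c → toggled G a b c ≡ A c b
  toggled≡ c with c ≟ b
  ... | yes refl = refl
  ... | no  _    = refl

  -- On matrices, sliding adds row `b` to row `a` and column `b` to column `a`, which is the passage
  -- from `a` to the formal sum.
  adjacencyMatrix-slide : ∀ i j →
    adjacencyMatrix G̃ i j ≡ extended (relabel i) (relabel j)
  adjacencyMatrix-slide i j with i ≟ a | j ≟ a | i ≟ j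
  ... | yes refl | yes refl | yes _    =
    sym (cong₂ _xor_ (adjacencyMatrix-diag G a) (adjacencyMatrix-diag G b))
  ... | yes refl | yes refl | no  i≢j  = contradiction refl i≢j
  ... | yes refl | no  j≢a  | yes refl = contradiction refl j≢a
  ... | yes refl | no  j≢a  | no  i≢j  = cong₂ _xor_
    (sym (adjacencyMatrix-off G i≢j))
    (trans (toggled≡ j) (adjacencyMatrix-sym G j b))
  ... | no  i≢a  | yes refl | yes refl = contradiction refl i≢a
  ... | no  i≢a  | yes refl | no  i≢j  =
    cong₂ _xor_ (sym (adjacencyMatrix-off G i≢j)) (toggled≡ i)
  ... | no  _    | no  _    | yes refl = sym (adjacencyMatrix-diag G i)
  ... | no  _    | no  _    | no  i≢j  = sym (adjacencyMatrix-off G i≢j)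

  d≡principal : ∀ U → d U ≡ principal extended (map just (members U))
  d≡principal U = trans (det-induced G U)
    (sym (perm-map extended just just (members U) (members U)))

  d̃≡principal : ∀ U → d̃ U ≡ principal extended (map relabel (members U))
  d̃≡principal U = begin
    d̃ U
      ≡⟨ det-induced G̃ U ⟩
    principal (adjacencyMatrix G̃) (members U)
      ≡⟨ perm-cong adjacencyMatrix-slide (members U) (members U) ⟩
    principal (λ i j → extended (relabel i) (relabel j)) (members U)
      ≡⟨ perm-map extended relabel relabel (members U) (members U) ⟨
    principal extended (map relabel (members U)) ∎

  d-∪⁅⁆ : ∀ {φ x} → x ∉ φ →
    d (φ ∪ ⁅ x ⁆) ≡ principal extended (just x ∷ map just (members φ))
  d-∪⁅⁆ {φ} {x} x∉φ = trans (d≡principal (φ ∪ ⁅ x ⁆))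
    (principal-↭ extended (map⁺ just (members-∪⁅⁆ φ x∉φ)))

  -- The last summand is kept as a minor on a list because `b` may lie in `φ`; the list then repeats
  -- `b` and enumerates no subset.
  d̃-additive : ∀ {φ} → a ∉ φ → d̃ (φ ∪ ⁅ a ⁆) ≡
    d (φ ∪ ⁅ a ⁆) xor principal extended (just b ∷ map just (members φ))
  d̃-additive {φ} a∉φ = begin
    d̃ (φ ∪ ⁅ a ⁆)
      ≡⟨ d̃≡principal (φ ∪ ⁅ a ⁆) ⟩
    principal extended (map relabel (members (φ ∪ ⁅ a ⁆)))
      ≡⟨ principal-↭ extended (map⁺ relabel (members-∪⁅⁆ φ a∉φ)) ⟩
    principal extended (relabel a ∷ map relabel (members φ))
      ≡⟨ cong (principal extended) (cong₂ _∷_ relabel-a (relabel-members a∉φ)) ⟩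
    principal extended (nothing ∷ zs)
      ≡⟨ principal-additive extended-sym nothing (just a) (just b)
           extended-additive zs ⟩
    principal extended (just a ∷ zs) xor principal extended (just b ∷ zs)
      ≡⟨ cong (_xor principal extended (just b ∷ zs)) (d-∪⁅⁆ a∉φ) ⟨
    d (φ ∪ ⁅ a ⁆) xor principal extended (just b ∷ zs) ∎
    where zs = map just (members φ)

  d̃-a∉ : ∀ {U} → a ∉ U → d̃ U ≡ d U
  d̃-a∉ {U} a∉U = begin
    d̃ U
      ≡⟨ d̃≡principal U ⟩
    principal extended (map relabel (members U))
      ≡⟨ cong (principal extended) (relabel-members a∉U) ⟩
    principal extended (map just (members U))
      ≡⟨ d≡principal U ⟨
    d U ∎

  d̃-b∈ : ∀ {φ} → a ∉ φ → b ∈ φ → d̃ (φ ∪ ⁅ a ⁆) ≡ d (φ ∪ ⁅ a ⁆)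
  d̃-b∈ {φ} a∉φ b∈φ with ∈⇒∪⁅⁆ b∈φ
  ... | ψ , b∉ψ , refl = begin
    d̃ (φ ∪ ⁅ a ⁆)
      ≡⟨ d̃-additive a∉φ ⟩
    d (φ ∪ ⁅ a ⁆) xor principal extended (just b ∷ map just (members φ))
      -- The copy of `b` inside `φ` is moved next to the leading one, so that the repeated rows come
      -- first.
      ≡⟨ cong (d (φ ∪ ⁅ a ⁆) xor_) (principal-↭ extended
           (map⁺ just (↭-prep b (members-∪⁅⁆ ψ b∉ψ)))) ⟩
    d (φ ∪ ⁅ a ⁆) xor principal extended (just b ∷ just b ∷ zs)
      ≡⟨ cong (d (φ ∪ ⁅ a ⁆) xor_)
           (perm-repeatedRow extended (just b) zs (just b ∷ just b ∷ zs)) ⟩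
    d (φ ∪ ⁅ a ⁆) xor false
      ≡⟨ xor-identityʳ (d (φ ∪ ⁅ a ⁆)) ⟩
    d (φ ∪ ⁅ a ⁆) ∎
    where zs = map just (members ψ)

  d̃-b∉ : ∀ {φ} → a ∉ φ → b ∉ φ →
    d̃ (φ ∪ ⁅ a ⁆) ≡ d (φ ∪ ⁅ a ⁆) xor d (φ ∪ ⁅ b ⁆)
  d̃-b∉ {φ} a∉φ b∉φ =
    trans (d̃-additive a∉φ) (cong (d (φ ∪ ⁅ a ⁆) xor_) (sym (d-∪⁅⁆ b∉φ)))

  -- Comparison of the feasible sets

  private
    Φ = Feasible (nondegeneracyDeltaMatroid G)
    Ψ = Exchanged Φ a b

  -- The added minor `d (φ ∪ ⁅ b ⁆)` is 1 here, so feasibility flips, as it does under the symmetric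
  -- difference with `Ψ`.
  d̃-exchanged : ∀ {U} → Ψ U → d̃ U ≡ not (d U)
  d̃-exchanged (φ , a∉φ , b∉φ , Φφb , refl) = begin
    d̃ (φ ∪ ⁅ a ⁆)                    ≡⟨ d̃-b∉ a∉φ b∉φ ⟩
    d (φ ∪ ⁅ a ⁆) xor d (φ ∪ ⁅ b ⁆)  ≡⟨ cong (d (φ ∪ ⁅ a ⁆) xor_) (¬-not Φφb) ⟩
    d (φ ∪ ⁅ a ⁆) xor true           ≡⟨ xor-comm (d (φ ∪ ⁅ a ⁆)) true ⟩
    not (d (φ ∪ ⁅ a ⁆))              ∎

  -- A set fails to be exchanged because it lacks `a`, because it contains `b` besides `a`, or
  -- because `d (φ ∪ ⁅ b ⁆)` is 0. In each case nothing is added to `d U`.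
  d̃-¬exchanged : ∀ {U} → ¬ Ψ U → d̃ U ≡ d U
  d̃-¬exchanged {U} ¬ΨU with a ∈? U
  ... | no  a∉U = d̃-a∉ a∉U
  ... | yes a∈U with ∈⇒∪⁅⁆ a∈U
  ...   | φ , a∉φ , refl with b ∈? φ
  ...     | yes b∈φ = d̃-b∈ a∉φ b∈φ
  ...     | no  b∉φ with d (φ ∪ ⁅ b ⁆) in eq
  ...       | true  = contradiction (φ , a∉φ , b∉φ , not-¬ eq , refl) ¬ΨU
  ...       | false = begin
    d̃ (φ ∪ ⁅ a ⁆)                    ≡⟨ d̃-b∉ a∉φ b∉φ ⟩
    d (φ ∪ ⁅ a ⁆) xor d (φ ∪ ⁅ b ⁆)  ≡⟨ cong (d (φ ∪ ⁅ a ⁆) xor_) eq ⟩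
    d (φ ∪ ⁅ a ⁆) xor false          ≡⟨ xor-identityʳ (d (φ ∪ ⁅ a ⁆)) ⟩
    d (φ ∪ ⁅ a ⁆)                    ∎

theorem4p2 : ∀ {n : ℕ} (G : FramedGraph n) (a b : Fin n) (a≢b : a ≢ b) →
    nondegeneracyDeltaMatroid (slideGraph G a b) ≋ slide (nondegeneracyDeltaMatroid G) a b a≢b
theorem4p2 G a b a≢b = to , from
  where
  D = nondegeneracyDeltaMatroid G
  Φ = Feasible D
  Ψ = Exchanged Φ a b
  Φ̃ = Feasible (nondegeneracyDeltaMatroid (slideGraph G a b))

  to : ∀ {U} → Φ̃ U → (Φ Δ Ψ) U
  to {U} Φ̃U with exchanged? Φ a b (feasible? D) U
  ... | no  ¬ΨU = inj₁ (Φ̃U ∘ trans (d̃-¬exchanged G a b ¬ΨU) , ¬ΨU)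
  ... | yes ΨU  =
    inj₂ ((λ ΦU → Φ̃U (trans (d̃-exchanged G a b ΨU) (cong not (¬-not ΦU)))) , ΨU)

  from : ∀ {U} → (Φ Δ Ψ) U → Φ̃ U
  from (inj₁ (ΦU , ¬ΨU)) eq = ΦU (trans (sym (d̃-¬exchanged G a b ¬ΨU)) eq)
  -- `¬ΦU` is the double negation of `d U ≡ false`; as the goal is absurdity, `d U ≡ false` may be
  -- assumed.
  from (inj₂ (¬ΦU , ΨU)) eq =
    ¬ΦU λ dU≡false →
      not-¬ (trans (d̃-exchanged G a b ΨU) (cong not dU≡false)) eq
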